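{- Let $G$ be a finite $2$-connected graph. Then every edge of $G$ is contained in a cycle of $G$ whose length is at least $\operatorname{td}(G)$. Consequently, $\operatorname{td}(G)$ is at most the circumference of $G$.
   Context: All graphs are finite and simple. A connected graph $G$ is $2$-connected if it has at least three vertices and no cutvertex (a vertex $x$ such that $G-x$ is disconnected). The circumference of $G$ is the length (number of edges) of a longest cycle in $G$, or $+\infty$ if $G$ has no cycle. An elimination forest of a graph $G$ is a rooted forest with trees $T_1,\dots,T_p$ such that $V(T_1),\dots,V(T_p)$ partition $V(G)$ and, for every edge $xy\in E(G)$, $x$ and $y$ lie in the same tree $T_i$ and one of them is an ancestor of the other in $T_i$. Its vertex-height is the maximum number of vertices on a root-to-leaf path in any of its trees. The treedepth $\operatorname{td}(G)$ is the minimum vertex-height of an elimination forest of $G$. -}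

module Defs where

open import Data.Nat using (ℕ; zero; suc; _≤_)
open import Data.Fin using (Fin)
open import Data.Maybe using (Maybe; just; nothing)
open import Data.List using (List; []; _∷_; length)
open import Data.List.Relation.Unary.Unique.Propositional using (Unique)
open import Data.List.Relation.Unary.Linked using (Linked)
open import Data.List.Membership.Propositional using (_∈_)
open import Data.Product using (Σ; _×_; _,_; ∃)
open import Data.Sum using (_⊎_)
open import Data.Empty using (⊥)
open import Relation.Nullary using (¬_; Dec)
open import Relation.Binary.PropositionalEquality using (_≡_; _≢_)
open import Relation.Binary.Construct.Closure.ReflexiveTransitive using (Star)

record Graph (n : ℕ) : Set₁ where
  field
    Adj    : Fin n → Fin n → Set
    adj?   : ∀ x y → Dec (Adj x y)
    sym    : ∀ {x y} → Adj x y → Adj y x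
    irrefl : ∀ {x} → ¬ Adj x x
open Graph public

Connected : ∀ {n} → Graph n → Set
Connected G = ∀ y z → Star (Adj G) y z

AdjMinus : ∀ {n} → Graph n → Fin n → Fin n → Fin n → Set
AdjMinus G x a b = Adj G a b × a ≢ x × b ≢ x

ConnectedMinus : ∀ {n} → Graph n → Fin n → Set
ConnectedMinus G x = ∀ y z → y ≢ x → z ≢ x → Star (AdjMinus G x) y z

TwoConnected : ∀ {n} → Graph n → Set
TwoConnected {n} G = (3 ≤ n) × Connected G × (∀ x → ConnectedMinus G x)

lastOf : ∀ {A : Set} → A → List A → A
lastOf v []       = v
lastOf v (w ∷ ws) = lastOf w ws

cyclePairs : ∀ {A : Set} → A → List A → List (A × A)
cyclePairs {A} v vs = go v vs
  where
  go : A → List A → List (A × A)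
  go a []       = (a , v) ∷ []
  go a (b ∷ bs) = (a , b) ∷ go b bs

record Cycle {n} (G : Graph n) : Set where
  constructor mkCycle
  field
    start   : Fin n
    rest    : List (Fin n)
    atLeast3 : 3 ≤ length (start ∷ rest)
    distinct : Unique (start ∷ rest)
    chain   : Linked (Adj G) (start ∷ rest)
    closing : Adj G (lastOf start rest) start
open Cycle public

cycleLength : ∀ {n} {G : Graph n} → Cycle G → ℕ
cycleLength C = length (start C ∷ rest C)

EdgeOfCycle : ∀ {n} {G : Graph n} → Fin n → Fin n → Cycle G → Set
EdgeOfCycle x y C = ((x , y) ∈ cyclePairs (start C) (rest C))
                  ⊎ ((y , x) ∈ cyclePairs (start C) (rest C))

IsCircumference : ∀ {n} → Graph n → ℕ → Set
IsCircumference G c = (Σ (Cycle G) λ C → cycleLength C ≡ c)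
                    × (∀ (C : Cycle G) → cycleLength C ≤ c)

-- A rooted forest on Fin n, given by a parent map; `depth v` is the number of
-- vertices on the path from v up to its root (its existence forces acyclicity).
record RootedForest (n : ℕ) : Set where
  field
    parent     : Fin n → Maybe (Fin n)
    depth      : Fin n → ℕ
    depth-root : ∀ v → parent v ≡ nothing → depth v ≡ 1
    depth-step : ∀ v u → parent v ≡ just u → depth v ≡ suc (depth u)
open RootedForest public

ParentOf : ∀ {n} → RootedForest n → Fin n → Fin n → Set
ParentOf F u v = parent F v ≡ just u

AncestorOf : ∀ {n} → RootedForest n → Fin n → Fin n → Set
AncestorOf F = Star (ParentOf F)

IsEliminationForest : ∀ {n} → Graph n → RootedForest n → Set
IsEliminationForest G F = ∀ x y → Adj G x y → AncestorOf F x y ⊎ AncestorOf F y x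

HeightAtMost : ∀ {n} → RootedForest n → ℕ → Set
HeightAtMost F k = ∀ v → depth F v ≤ k

-- td(G) ≤ k  (td is the minimum vertex-height of an elimination forest)
TdAtMost : ∀ {n} → Graph n → ℕ → Set
TdAtMost {n} G k = Σ (RootedForest n) λ F → IsEliminationForest G F × HeightAtMost F k

{-# OPTIONS --safe #-}

-- For an edge xy, we look for a long path in G - x from y to a neighbour of x, by induction on the
-- vertex set S. Some vertices v of S are targets, each with a bonus h v > 0 (h v = 0 marks a
-- non-target), and every part of S cut off from the root y by at most one vertex contains a target.
-- Then there are a path from y to a target a with k edges and an elimination tree of S rooted at y
-- in which level v + max 1 (h v) ≤ k + h a for all v, roots having level 0.
-- If a vertex c cuts off a set D, solve D ∪ {c} rooted at c, raise the bonus of c to the weight k + h a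
-- obtained there, solve S ∖ D, and hang the tree of D below c.  Otherwise let c ≠ y be a target of
-- maximum bonus: solve S - y rooted at c with the neighbours of y as targets of bonus 1, reverse
-- the path so that it leads from y to c, and put y on top of the tree.
module Submission where

open import Defs
open import Data.Nat using (ℕ; zero; suc; _+_; _⊔_; _≤_; _<_; z≤n; s≤s; s≤s⁻¹; _≤?_)
open import Data.Nat.Properties as ℕ using (≤-refl; ≤-trans; ≤-reflexive; <-≤-trans)
open import Data.Fin using (Fin; zero; suc; _≟_)
open import Data.Fin.Properties using (any?; all?)
open import Data.Fin.Subset using (Subset; _∈_; _∉_; _⊆_; ⁅_⁆; ⊤; _∪_; _─_; _-_; ∣_∣; Nonempty; inside; outside)
open import Data.Fin.Subset.Properties
open import Data.Vec using (here; there; _∷_)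
open import Data.Vec.Functional using (updateAt)
open import Data.Vec.Functional.Properties using (updateAt-updates; updateAt-minimal)
open import Data.Maybe using (Maybe; just; nothing)
open import Data.Maybe.Properties using (just-injective)
open import Data.List using ([]; _∷_; length; filter; allFin)
open import Data.List.Extrema ℕ.≤-totalOrder using (argmax; argmax-all; f[xs]≤f[argmax])
open import Data.List.Membership.Propositional.Properties using (∈-filter⁺; ∈-allFin)
open import Data.List.Relation.Unary.All using (All; []; _∷_) renaming (map to All-map; lookup to All-lookup)
open import Data.List.Relation.Unary.All.Properties using (all-filter)
open import Data.List.Relation.Unary.Any using (here)
open import Data.List.Relation.Unary.AllPairs using ([]; _∷_)
open import Data.List.Relation.Unary.Linked using (Linked; [-]; _∷_)
open import Data.List.Relation.Unary.Unique.Propositional using (Unique)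
open import Data.Product using (Σ; _×_; _,_; ∃; ∃₂; proj₁; proj₂)
open import Data.Sum using (_⊎_; inj₁; inj₂) renaming (map to ⊎-map)
open import Function using (_∘_; case_of_; const)
open import Relation.Nullary using (¬_; Dec; yes; no; contradiction)
open import Relation.Nullary.Decidable using (map′; ¬?; _×-dec_; _→-dec_)
open import Relation.Binary.Construct.Closure.ReflexiveTransitive using (Star; ε; _◅_; _◅◅_)
open import Relation.Binary.PropositionalEquality as ≡ using (_≡_; _≢_; refl; cong; subst; ≢-sym)

private
  variable
    n k l : ℕ
    x y z : Fin n
    S T D : Subset n

-- Finite subsets, maxima and piecewise functions.

x∈p─q⇒x∉q : (p q : Subset n) → x ∈ p ─ q → x ∉ q
x∈p─q⇒x∉q (_ ∷ p) (outside ∷ q) (there x∈) (there x∈q) = x∈p─q⇒x∉q p q x∈ x∈q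
x∈p─q⇒x∉q (_ ∷ p) (inside  ∷ q) (there x∈) (there x∈q) = x∈p─q⇒x∉q p q x∈ x∈q

x∈p-y⇒x∈p : x ∈ S - y → x ∈ S
x∈p-y⇒x∈p {S = S} {y = y} = p─q⊆p S ⁅ y ⁆

x∈p-y⇒x≢y : x ∈ S - y → x ≢ y
x∈p-y⇒x≢y {S = S} {y = y} x∈ = x∉⁅y⁆⇒x≢y (x∈p─q⇒x∉q S ⁅ y ⁆ x∈)

y∉p-y : (S : Subset n) → y ∉ S - y
y∉p-y S y∈ = x∈p-y⇒x≢y y∈ refl

p-x-mono : S ⊆ T → S - x ⊆ T - x
p-x-mono S⊆T v∈ = x∈p∧x≢y⇒x∈p-y (S⊆T (x∈p-y⇒x∈p v∈)) (x∈p-y⇒x≢y v∈)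

∃-argmax : (f : Fin n → ℕ) (S : Subset n) → Nonempty S → ∃ λ c → c ∈ S × (∀ {v} → v ∈ S → f v ≤ f c)
∃-argmax {n} f S (s , s∈) =
  argmax f s vs , argmax-all f s∈ (all-filter (_∈? S) (allFin n)) ,
  λ {v} v∈ → All-lookup (f[xs]≤f[argmax] s vs) (∈-filter⁺ (_∈? S) (∈-allFin v) v∈)
  where
  vs = filter (_∈? S) (allFin n)

Star-crossing : {R : Fin n → Fin n → Set} (D : Subset n) → Star R x y → x ∈ D → y ∉ D →
                ∃₂ λ u v → u ∈ D × v ∉ D × R u v
Star-crossing D ε x∈ y∉ = contradiction x∈ y∉
Star-crossing D (_◅_ {j = z} xz zs) x∈ y∉ with z ∈? D
... | yes z∈ = Star-crossing D zs z∈ y∉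
... | no  z∉ = _ , _ , x∈ , z∉ , xz

third-element : 3 ≤ n → (x y : Fin n) → ∃ λ z → z ≢ x × z ≢ y
third-element (s≤s (s≤s (s≤s _))) zero          zero          = suc zero , (λ ()) , (λ ())
third-element (s≤s (s≤s (s≤s _))) zero          (suc zero)    = suc (suc zero) , (λ ()) , (λ ())
third-element (s≤s (s≤s (s≤s _))) zero          (suc (suc _)) = suc zero , (λ ()) , (λ ())
third-element (s≤s (s≤s (s≤s _))) (suc zero)    zero          = suc (suc zero) , (λ ()) , (λ ())
third-element (s≤s (s≤s (s≤s _))) (suc (suc _)) zero          = suc zero , (λ ()) , (λ ())
third-element (s≤s (s≤s (s≤s _))) (suc _)       (suc _)       = zero , (λ ()) , (λ ())

module _ {A : Set} (D : Subset n) (f g : Fin n → A) where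

  merge : Fin n → A
  merge v with v ∈? D
  ... | yes _ = f v
  ... | no  _ = g v

  merge-∈ : x ∈ D → merge x ≡ f x
  merge-∈ {x} x∈ with x ∈? D
  ... | yes _  = refl
  ... | no  x∉ = contradiction x∈ x∉

  merge-∉ : x ∉ D → merge x ≡ g x
  merge-∉ {x} x∉ with x ∈? D
  ... | yes x∈ = contradiction x∈ x∉
  ... | no  _  = refl

Up : (Fin n → Maybe (Fin n)) → Fin n → Fin n → Set
Up up u v = up v ≡ just u

module _ {n : ℕ} (G : Graph n) where

  -- Paths

  -- Each step deletes its vertex from the index set, so a `Path` is simple by construction.
  data Path : Subset n → Fin n → Fin n → ℕ → Set where
    [_]   : x ∈ S → Path S x x 0
    _∷⟨_⟩_ : x ∈ S → Adj G x z → Path (S - x) z y k → Path S x y (suc k)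

  Path-mono : S ⊆ T → Path S x y k → Path T x y k
  Path-mono S⊆T [ x∈ ] = [ S⊆T x∈ ]
  Path-mono S⊆T (x∈ ∷⟨ e ⟩ p) =
    S⊆T x∈ ∷⟨ e ⟩ Path-mono (p-x-mono S⊆T) p

  Path-end : Path S x y k → y ∈ S
  Path-end [ x∈ ]       = x∈
  Path-end (_ ∷⟨ _ ⟩ p) = x∈p-y⇒x∈p (Path-end p)

  Path-snoc : S ⊆ T → Path S x y k → Adj G y z → z ∈ T → z ∉ S → Path T x z (suc k)
  Path-snoc S⊆T [ x∈ ] e z∈ z∉ =
    S⊆T x∈ ∷⟨ e ⟩ [ x∈p∧x≢y⇒x∈p-y z∈ (λ { refl → z∉ x∈ }) ]
  Path-snoc S⊆T (x∈ ∷⟨ e′ ⟩ p) e z∈ z∉ =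
    S⊆T x∈ ∷⟨ e′ ⟩ Path-snoc (p-x-mono S⊆T)
      p e (x∈p∧x≢y⇒x∈p-y z∈ (λ { refl → z∉ x∈ })) (z∉ ∘ x∈p-y⇒x∈p)

  Path-reverse : Path S x y k → Path S y x k
  Path-reverse [ x∈ ] = [ x∈ ]
  Path-reverse {S = S} (x∈ ∷⟨ e ⟩ p) =
    Path-snoc x∈p-y⇒x∈p (Path-reverse p) (sym G e) x∈ (y∉p-y S)

  Path-append : S ⊆ D → T ⊆ D → (∀ {v} → v ∈ S → v ∈ T → v ≡ y) →
                Path S x y k → Path T y z l → Path D x z (k + l)
  Path-append S⊆ T⊆ meet [ _ ] q = Path-mono T⊆ q
  Path-append S⊆ T⊆ meet (x∈ ∷⟨ e ⟩ p) q =
    S⊆ x∈ ∷⟨ e ⟩ Path-append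
      (p-x-mono S⊆)
      -- Deleting `x` costs `T` nothing: if `x` lay in `T` it would be the meeting point `y`, but
      -- `y` ends the tail `p`, which avoids `x`.
      (λ v∈ → x∈p∧x≢y⇒x∈p-y (T⊆ v∈)
        (λ { refl → x∈p-y⇒x≢y (Path-end p) (≡.sym (meet x∈ v∈)) }))
      (λ v∈ → meet (x∈p-y⇒x∈p v∈)) p q

  Path-vertices : Path S x y k → ∃ λ vs →
    length vs ≡ k × lastOf x vs ≡ y × All (_∈ S) (x ∷ vs) × Unique (x ∷ vs) × Linked (Adj G) (x ∷ vs)
  Path-vertices [ x∈ ] = [] , refl , refl , x∈ ∷ [] , [] ∷ [] , [-]
  Path-vertices {x = x} (x∈ ∷⟨ e ⟩ p) with Path-vertices p
  ... | vs , len , last , vs∈ , uniq , link =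
    _ ∷ vs , cong suc len , last , x∈ ∷ All-map x∈p-y⇒x∈p vs∈ ,
    All-map (λ v∈ → ≢-sym (x∈p-y⇒x≢y v∈)) vs∈ ∷ uniq , e ∷ link

  -- Elimination trees of induced subgraphs

  -- Both maps are total, with arbitrary values away from `S` and `r`, so trees can be glued by
  -- overwriting the maps.
  record ElimTree (S : Subset n) (r : Fin n) : Set where
    field
      up         : Fin n → Maybe (Fin n)
      level      : Fin n → ℕ
      up-root    : up r ≡ nothing
      level-root : level r ≡ 0
      up-step    : ∀ {v} → v ∈ S → v ≢ r → ∃ λ u → u ∈ S × up v ≡ just u × level v ≡ suc (level u)
      comparable : ∀ {u v} → u ∈ S → v ∈ S → Adj G u v → Star (Up up) u v ⊎ Star (Up up) v u

    up≢root : ∀ {u v} → up v ≡ just u → v ≢ r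
    up≢root eq refl with () ← ≡.trans (≡.sym up-root) eq

    -- A chain ending at `v` in `S` stays in `S` on its way up, and no step of it leads up from `r`,
    -- which has no parent. So `up′` may give `r` a new parent, which is how a tree is hung below
    -- another vertex.
    Star-transfer : ∀ {up′ u v} → (∀ {w} → w ∈ S → w ≢ r → up′ w ≡ up w) → v ∈ S →
                    Star (Up up) u v → u ∈ S × Star (Up up′) u v
    Star-transfer agree v∈ ε = v∈ , ε
    Star-transfer agree v∈ (_◅_ {j = w} eq s) with Star-transfer agree v∈ s
    ... | w∈ , s′ with up-step w∈ (up≢root eq)
    ...   | u′ , u′∈ , eq′ , _ =
      subst (_∈ S) (just-injective (≡.trans (≡.sym eq′) eq)) u′∈ ,
      ≡.trans (agree w∈ (up≢root eq)) eq ◅ s′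

    root-above : ∀ m {v} → level v ≤ m → v ∈ S → Star (Up up) r v
    root-above m {v} lv v∈ with v ≟ r
    ... | yes refl = ε
    ... | no v≢r with up-step v∈ v≢r
    root-above zero    lv v∈ | no _ | _ , _ , _ , lv≡ with () ← subst (_≤ 0) lv≡ lv
    root-above (suc m) lv v∈ | no _ | u , u∈ , eq , lv≡ =
      root-above m (s≤s⁻¹ (subst (_≤ suc m) lv≡ lv)) u∈ ◅◅ (eq ◅ ε)

  open ElimTree

  -- Together the two bounds say that `level t v` plus the maximum of 1 and `h v` is at most `W`;
  -- the strict one matters for non-targets.
  HeightAtMostWith : ElimTree S y → (Fin n → ℕ) → ℕ → Set
  HeightAtMostWith {S = S} t h W = ∀ {v} → v ∈ S → level t v < W × level t v + h v ≤ W

  addRoot : ∀ {c} → y ∈ S → c ∈ S - y → (t : ElimTree (S - y) c) →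
            Σ (ElimTree S y) λ t′ → ∀ {v} → v ≢ y → level t′ v ≡ suc (level t v)
  addRoot {y = y} {S = S} {c = c} y∈ c∈ t = t′ , level-≢
    where
    up₀ up₁ : Fin n → Maybe (Fin n)
    up₀ = updateAt (up t) c (const (just y))
    up₁ = updateAt up₀ y (const nothing)

    level₁ : Fin n → ℕ
    level₁ = updateAt (suc ∘ level t) y (const 0)

    level-≢ : ∀ {v} → v ≢ y → level₁ v ≡ suc (level t v)
    level-≢ v≢y = updateAt-minimal _ y (suc ∘ level t) v≢y

    up-c : up₁ c ≡ just y
    up-c = ≡.trans (updateAt-minimal c y up₀ (x∈p-y⇒x≢y c∈)) (updateAt-updates c (up t))

    agree : ∀ {v} → v ∈ S - y → v ≢ c → up₁ v ≡ up t v
    agree v∈ v≢c = ≡.trans (updateAt-minimal _ y up₀ (x∈p-y⇒x≢y v∈)) (updateAt-minimal _ c (up t) v≢c)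

    y-above : ∀ {v} → v ∈ S - y → Star (Up up₁) y v
    y-above v∈ = up-c ◅ proj₂ (Star-transfer t agree v∈ (root-above t _ ≤-refl v∈))

    step : ∀ {v} → v ∈ S → v ≢ y → ∃ λ u → u ∈ S × up₁ v ≡ just u × level₁ v ≡ suc (level₁ u)
    step {v} v∈ v≢y with v ≟ c
    ... | yes refl = y , y∈ , up-c ,
          ≡.trans (level-≢ v≢y)
            (cong suc (≡.trans (level-root t) (≡.sym (updateAt-updates y (suc ∘ level t)))))
    ... | no v≢c with up-step t (x∈p∧x≢y⇒x∈p-y v∈ v≢y) v≢c
    ...   | u , u∈ , eq , lv = u , x∈p-y⇒x∈p u∈ , ≡.trans (agree (x∈p∧x≢y⇒x∈p-y v∈ v≢y) v≢c) eq ,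
            ≡.trans (level-≢ v≢y) (cong suc (≡.trans lv (≡.sym (level-≢ (x∈p-y⇒x≢y u∈)))))

    comp : ∀ {u v} → u ∈ S → v ∈ S → Adj G u v → Star (Up up₁) u v ⊎ Star (Up up₁) v u
    comp {u} {v} u∈ v∈ e with u ≟ y | v ≟ y
    ... | yes refl | yes refl = contradiction e (irrefl G)
    ... | yes refl | no v≢y   = inj₁ (y-above (x∈p∧x≢y⇒x∈p-y v∈ v≢y))
    ... | no u≢y   | yes refl = inj₂ (y-above (x∈p∧x≢y⇒x∈p-y u∈ u≢y))
    ... | no u≢y   | no v≢y   =
      ⊎-map (proj₂ ∘ Star-transfer t agree v∈′) (proj₂ ∘ Star-transfer t agree u∈′)
            (comparable t u∈′ v∈′ e)
      where
      u∈′ = x∈p∧x≢y⇒x∈p-y u∈ u≢y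
      v∈′ = x∈p∧x≢y⇒x∈p-y v∈ v≢y

    t′ : ElimTree S y
    t′ = record
      { up = up₁ ; level = level₁
      ; up-root = updateAt-updates y up₀ ; level-root = updateAt-updates y (suc ∘ level t)
      ; up-step = step ; comparable = comp }

  singletonTree : (∀ {v} → v ∈ S → v ≡ y) → ElimTree S y
  singletonTree S⊆y = record
    { up = const nothing ; level = const 0 ; up-root = refl ; level-root = refl
    ; up-step = λ v∈ v≢y → contradiction (S⊆y v∈) v≢y
    ; comparable = λ u∈ v∈ e → contradiction (subst (Adj G _) (≡.trans (S⊆y v∈) (≡.sym (S⊆y u∈))) e) (irrefl G) }

  -- Separations

  Closed : Subset n → Subset n → Set
  Closed S D = ∀ {u v} → u ∈ D → v ∈ S → v ∉ D → ¬ Adj G u v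

  OnlyExit : Subset n → Subset n → Fin n → Set
  OnlyExit S D c = ∀ {u v} → u ∈ D → v ∈ S → v ∉ D → Adj G u v → v ≡ c

  onlyExit? : ∀ S D c → Dec (OnlyExit S D c)
  onlyExit? S D c = map′ (λ f {u} {v} → f u v) (λ f u v → f {u} {v})
    (all? λ u → all? λ v → (u ∈? D) →-dec (v ∈? S) →-dec ¬? (v ∈? D) →-dec adj? G u v →-dec (v ≟ c))

  -- `c` may be `y` itself. `nonempty` makes `S ─ D` smaller than `S`, and `other` makes `D ∪ ⁅ c ⁆`
  -- smaller, so the induction applies to both.
  record Separation (S : Subset n) (y c : Fin n) (D : Subset n) : Set where
    field
      D⊆S      : D ⊆ S
      y∉D      : y ∉ D
      nonempty : Nonempty D
      c∈S      : c ∈ S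
      c∉D      : c ∉ D
      exit     : OnlyExit S D c
      other    : ∃ λ v → v ∈ S × v ∉ D × v ≢ c

  separation? : ∀ S y → Dec (∃₂ (Separation S y))
  separation? S y = any? λ c → anySubset? λ D → map′
    (λ (a , b , d , e , f , g , h) → record
      { D⊆S = a ; y∉D = b ; nonempty = d ; c∈S = e ; c∉D = f ; exit = g ; other = h })
    (λ s → let open Separation s in (λ {x} → D⊆S {x}) , y∉D , nonempty , c∈S , c∉D , (λ {u} {v} → exit {u} {v}) , other)
    ((D ⊆? S) ×-dec ¬? (y ∈? D) ×-dec nonempty? D ×-dec (c ∈? S) ×-dec ¬? (c ∈? D) ×-dec
      onlyExit? S D c ×-dec any? λ v → (v ∈? S) ×-dec ¬? (v ∈? D) ×-dec ¬? (v ≟ c))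

  -- An edge leaving `D` within `S` ends at `c`, so every edge of `G[S]` lies inside one of the two
  -- pieces and is comparable in the tree of that piece.
  attach : ∀ {c} → Separation S y c D → (t : ElimTree (S ─ D) y) (t₂ : ElimTree (D ∪ ⁅ c ⁆) c) →
           Σ (ElimTree S y) λ t′ → (∀ {v} → v ∉ D → level t′ v ≡ level t v)
                                 × (∀ {v} → v ∈ D → level t′ v ≡ level t₂ v + level t c)
  attach {S = S} {y = y} {D = D} {c = c} sep t t₂ = t′ , merge-∉ D lv₂ (level t) , merge-∈ D lv₂ (level t)
    where
    open Separation sep

    lv₂ lv : Fin n → ℕ
    lv₂ v = level t₂ v + level t c
    lv    = merge D lv₂ (level t)

    up′ : Fin n → Maybe (Fin n)
    up′ = merge D (up t₂) (up t)

    E F : Subset n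
    E = S ─ D
    F = D ∪ ⁅ c ⁆

    D⊆F : D ⊆ F
    D⊆F v∈ = x∈p∪q⁺ (inj₁ v∈)

    c∈F : c ∈ F
    c∈F = x∈p∪q⁺ (inj₂ (x∈⁅x⁆ c))

    agree₁ : ∀ {v} → v ∈ E → v ≢ y → up′ v ≡ up t v
    agree₁ v∈ _ = merge-∉ D (up t₂) (up t) (x∈p─q⇒x∉q S D v∈)

    agree₂ : ∀ {v} → v ∈ F → v ≢ c → up′ v ≡ up t₂ v
    agree₂ v∈ v≢c with x∈p∪q⁻ D ⁅ c ⁆ v∈
    ... | inj₁ v∈D = merge-∈ D (up t₂) (up t) v∈D
    ... | inj₂ v∈c = contradiction (x∈⁅y⁆⇒x≡y c v∈c) v≢c

    lv-F : ∀ {v} → v ∈ F → lv v ≡ level t₂ v + level t c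
    lv-F v∈ with x∈p∪q⁻ D ⁅ c ⁆ v∈
    ... | inj₁ v∈D = merge-∈ D lv₂ (level t) v∈D
    ... | inj₂ v∈c with x∈⁅y⁆⇒x≡y c v∈c
    -- The formula for `D` extends to `c` because `t₂` puts its root on level 0.
    ...   | refl = ≡.trans (merge-∉ D lv₂ (level t) c∉D) (cong (_+ level t c) (≡.sym (level-root t₂)))

    F⊆S : F ⊆ S
    F⊆S v∈ with x∈p∪q⁻ D ⁅ c ⁆ v∈
    ... | inj₁ v∈D = D⊆S v∈D
    ... | inj₂ v∈c = subst (_∈ S) (≡.sym (x∈⁅y⁆⇒x≡y c v∈c)) c∈S

    step : ∀ {v} → v ∈ S → v ≢ y → ∃ λ u → u ∈ S × up′ v ≡ just u × lv v ≡ suc (lv u)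
    step {v} v∈ v≢y = case v ∈? D of λ where
      (yes v∈D) → let v≢c = λ v≡c → c∉D (subst (_∈ D) v≡c v∈D)
                      u , u∈ , eq , l = up-step t₂ (D⊆F v∈D) v≢c
                  in u , F⊆S u∈ , ≡.trans (agree₂ (D⊆F v∈D) v≢c) eq ,
                     ≡.trans (lv-F (D⊆F v∈D))
                       (≡.trans (cong (_+ level t c) l) (cong suc (≡.sym (lv-F u∈))))
      (no v∉D)  → let v∈E = x∈p∧x∉q⇒x∈p─q v∈ v∉D
                      u , u∈ , eq , l = up-step t v∈E v≢y
                  in u , p─q⊆p S D u∈ , ≡.trans (agree₁ v∈E v≢y) eq ,
                     ≡.trans (merge-∉ D lv₂ (level t) v∉D)
                       (≡.trans l (cong suc (≡.sym (merge-∉ D lv₂ (level t) (x∈p─q⇒x∉q S D u∈)))))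

    comp-F : ∀ {u v} → u ∈ F → v ∈ F → Adj G u v → Star (Up up′) u v ⊎ Star (Up up′) v u
    comp-F u∈ v∈ e = ⊎-map (proj₂ ∘ Star-transfer t₂ agree₂ v∈) (proj₂ ∘ Star-transfer t₂ agree₂ u∈)
                           (comparable t₂ u∈ v∈ e)

    comp : ∀ {u v} → u ∈ S → v ∈ S → Adj G u v → Star (Up up′) u v ⊎ Star (Up up′) v u
    comp {u} {v} u∈ v∈ e with u ∈? D | v ∈? D
    ... | yes u∈D | yes v∈D = comp-F (D⊆F u∈D) (D⊆F v∈D) e
    ... | yes u∈D | no  v∉D = comp-F (D⊆F u∈D) (subst (_∈ F) (≡.sym (exit u∈D v∈ v∉D e)) c∈F) e
    ... | no  u∉D | yes v∈D = comp-F (subst (_∈ F) (≡.sym (exit v∈D u∈ u∉D (sym G e))) c∈F) (D⊆F v∈D) e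
    ... | no  u∉D | no  v∉D =
      ⊎-map (proj₂ ∘ Star-transfer t agree₁ v∈E) (proj₂ ∘ Star-transfer t agree₁ u∈E) (comparable t u∈E v∈E e)
      where
      u∈E = x∈p∧x∉q⇒x∈p─q u∈ u∉D
      v∈E = x∈p∧x∉q⇒x∈p─q v∈ v∉D

    t′ : ElimTree S y
    t′ = record
      { up = up′ ; level = lv
      ; up-root = ≡.trans (merge-∉ D (up t₂) (up t) y∉D) (up-root t)
      ; level-root = ≡.trans (merge-∉ D lv₂ (level t) y∉D) (level-root t)
      ; up-step = step ; comparable = comp }

  -- Long paths to the targets

  NoTarget : (Fin n → ℕ) → Subset n → Set
  NoTarget h D = ∀ {a} → a ∈ D → h a ≡ 0

  -- D ranges over unions of components of G[S] in `connected`, of G[S] - c in `targeted`.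
  record Admissible (S : Subset n) (y : Fin n) (h : Fin n → ℕ) : Set where
    field
      root∈     : y ∈ S
      connected : ∀ {D} → D ⊆ S → y ∉ D → Nonempty D → ¬ Closed S D
      targeted  : ∀ {D c} → D ⊆ S → y ∉ D → Nonempty D → c ∈ S → c ∉ D → OnlyExit S D c → ¬ NoTarget h D
      hasTarget : ¬ NoTarget h S

  record LongPath (S : Subset n) (y : Fin n) (h : Fin n → ℕ) : Set where
    field
      target : Fin n
      edges  : ℕ
      path   : Path S y target edges
      bonus  : 0 < h target
      tree   : ElimTree S y
      height : HeightAtMostWith tree h (edges + h target)

    weight : ℕ
    weight = edges + h target

  -- The bonus 1 stands for the edge back to `y` that a path ending at a neighbour of `y` can still
  -- take.
  nbr : Fin n → Fin n → ℕ
  nbr y v with adj? G v y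
  ... | yes _ = 1
  ... | no  _ = 0

  nbr-adj : ∀ {y v} → 0 < nbr y v → Adj G v y × nbr y v ≡ 1
  nbr-adj {y} {v} pos with adj? G v y
  ... | yes e = e , refl

  nbr-zero : ∀ {y v} → nbr y v ≡ 0 → ¬ Adj G v y
  nbr-zero {y} {v} z with adj? G v y
  ... | no ¬e = ¬e

  -- A vertex `c` cuts off a set `D`.

  module Separated {S y c D h} (adm : Admissible S y h) (sep : Separation S y c D) where

    open Admissible adm
    open Separation sep

    E F : Subset n
    E = S ─ D
    F = D ∪ ⁅ c ⁆

    c∈F : c ∈ F
    c∈F = x∈p∪q⁺ (inj₂ (x∈⁅x⁆ c))

    c∈E : c ∈ E
    c∈E = x∈p∧x∉q⇒x∈p─q c∈S c∉D

    F-cases : ∀ {v} → v ∈ F → v ∈ D ⊎ v ≡ c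
    F-cases v∈ with x∈p∪q⁻ D ⁅ c ⁆ v∈
    ... | inj₁ v∈D = inj₁ v∈D
    ... | inj₂ v∈c = inj₂ (x∈⁅y⁆⇒x≡y c v∈c)

    F⊆S : F ⊆ S
    F⊆S v∈ with F-cases v∈
    ... | inj₁ v∈D  = D⊆S v∈D
    ... | inj₂ refl = c∈S

    E⊆S : E ⊆ S
    E⊆S = p─q⊆p S D

    E∩F : ∀ {v} → v ∈ E → v ∈ F → v ≡ c
    E∩F v∈E v∈F with F-cases v∈F
    ... | inj₁ v∈D = contradiction v∈D (x∈p─q⇒x∉q S D v∈E)
    ... | inj₂ v≡c = v≡c

    ∣F∣<∣S∣ : ∣ F ∣ < ∣ S ∣
    ∣F∣<∣S∣ with other
    ... | v , v∈ , v∉D , v≢c = p⊂q⇒∣p∣<∣q∣ (F⊆S , v , v∈ , v∉F)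
      where
      v∉F : v ∉ F
      v∉F v∈F with F-cases v∈F
      ... | inj₁ v∈D = v∉D v∈D
      ... | inj₂ v≡c = v≢c v≡c

    ∣E∣<∣S∣ : ∣ E ∣ < ∣ S ∣
    ∣E∣<∣S∣ with nonempty
    ... | d , d∈ = p∩q≢∅⇒∣p─q∣<∣p∣ S D (d , x∈p∩q⁺ (D⊆S d∈ , d∈))

    -- A subset of `F` avoiding `c` lies in `D`, and its edges into `S` all end in `F`, so its exits
    -- in `F` are its exits in `S`, where `adm` applies. `D` itself has `c` as only exit and so
    -- supplies the target.
    admissible-F : Admissible F c h
    admissible-F = record
      { root∈     = c∈F
      ; connected = λ D′⊆ c∉ ne cl → connected (D⊆S ∘ shrink D′⊆ c∉) (y∉D ∘ shrink D′⊆ c∉) ne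
          λ u∈ v∈ v∉ e → cl u∈ (exits-in-F D′⊆ c∉ u∈ v∈ e) v∉ e
      ; targeted  = λ D′⊆ c∉ ne d∈ d∉ ex → targeted (D⊆S ∘ shrink D′⊆ c∉) (y∉D ∘ shrink D′⊆ c∉) ne (F⊆S d∈) d∉
          λ u∈ v∈ v∉ e → ex u∈ (exits-in-F D′⊆ c∉ u∈ v∈ e) v∉ e
      ; hasTarget = λ none → targeted D⊆S y∉D nonempty c∈S c∉D exit (λ a∈ → none (x∈p∪q⁺ (inj₁ a∈)))
      }
      where
      shrink : ∀ {D′} → D′ ⊆ F → c ∉ D′ → D′ ⊆ D
      shrink D′⊆ c∉ v∈ with F-cases (D′⊆ v∈)
      ... | inj₁ v∈D  = v∈D
      ... | inj₂ refl = contradiction v∈ c∉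

      exits-in-F : ∀ {D′ u v} → D′ ⊆ F → c ∉ D′ → u ∈ D′ → v ∈ S → Adj G u v → v ∈ F
      exits-in-F {v = v} D′⊆ c∉ u∈ v∈ e with v ∈? D
      ... | yes v∈D = x∈p∪q⁺ (inj₁ v∈D)
      ... | no  v∉D = subst (_∈ F) (≡.sym (exit (shrink D′⊆ c∉ u∈) v∈ v∉D e)) c∈F

    module _ (W : ℕ) (W>0 : 0 < W) where

      -- `W` will be the weight of a long path starting at `c` inside `F`: a path that reaches `c`
      -- can be continued along it.
      h⁺ : Fin n → ℕ
      h⁺ = updateAt h c (_⊔ W)

      h⁺-c : h⁺ c ≡ h c ⊔ W
      h⁺-c = updateAt-updates c h

      h⁺-≢ : ∀ {v} → v ≢ c → h⁺ v ≡ h v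
      h⁺-≢ v≢c = updateAt-minimal _ c h v≢c

      h≤h⁺ : ∀ v → h v ≤ h⁺ v
      h≤h⁺ v with v ≟ c
      ... | yes refl = ≤-trans (ℕ.m≤m⊔n (h c) W) (≤-reflexive (≡.sym h⁺-c))
      ... | no  v≢c  = ≤-reflexive (≡.sym (h⁺-≢ v≢c))

      W≤h⁺c : W ≤ h⁺ c
      W≤h⁺c = ≤-trans (ℕ.m≤n⊔m (h c) W) (≤-reflexive (≡.sym h⁺-c))

      h⁺c≢0 : h⁺ c ≢ 0
      h⁺c≢0 eq = ℕ.<⇒≢ (<-≤-trans W>0 W≤h⁺c) (≡.sym eq)

      -- A subset of `E` without `c` has no edge to `D`, so its exits in `E` and in `S` agree. A set
      -- without targets avoids `c`, because `h⁺ c` is positive.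
      admissible-E : Admissible E y h⁺
      admissible-E = record
        { root∈     = x∈p∧x∉q⇒x∈p─q root∈ y∉D
        ; connected = conn
        ; targeted  = λ {D′} D′⊆ y∉ ne d∈ d∉ ex none →
            let c∉ : c ∉ D′
                c∉ = λ c∈ → h⁺c≢0 (none c∈)
            in targeted (E⊆S ∘ D′⊆) y∉ ne (E⊆S d∈) d∉
                 (λ u∈ v∈ v∉ e → ex u∈ (exits-in-E D′⊆ c∉ u∈ v∈ e) v∉ e)
                 (λ {a} a∈ → ≡.trans (≡.sym (h⁺-≢ (λ a≡c → c∉ (subst (_∈ D′) a≡c a∈)))) (none a∈))
        ; hasTarget = λ none → h⁺c≢0 (none c∈E)
        }
        where
        exits-in-E : ∀ {D′ u v} → D′ ⊆ E → c ∉ D′ → u ∈ D′ → v ∈ S → Adj G u v → v ∈ E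
        exits-in-E {D′} {v = v} D′⊆ c∉ u∈ v∈ e with v ∈? D
        ... | yes v∈D = contradiction
                (subst (_∈ D′) (exit v∈D (E⊆S (D′⊆ u∈)) (x∈p─q⇒x∉q S D (D′⊆ u∈)) (sym G e)) u∈) c∉
        ... | no  v∉D = x∈p∧x∉q⇒x∈p─q v∈ v∉D

        conn : ∀ {D′} → D′ ⊆ E → y ∉ D′ → Nonempty D′ → ¬ Closed E D′
        conn {D′} D′⊆ y∉ ne cl with c ∈? D′
        ... | no c∉  = connected (E⊆S ∘ D′⊆) y∉ ne (λ u∈ v∈ v∉ e → cl u∈ (exits-in-E D′⊆ c∉ u∈ v∈ e) v∉ e)
        -- Edges from `c` into `D` may leave `D′`; adding all of `D` absorbs them, and the union is
        -- closed in `S`.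
        ... | yes c∈ = connected ∪⊆S y∉∪ (c , x∈p∪q⁺ (inj₁ c∈)) closed∪
          where
          ∪⊆S : D′ ∪ D ⊆ S
          ∪⊆S v∈ with x∈p∪q⁻ D′ D v∈
          ... | inj₁ v∈D′ = E⊆S (D′⊆ v∈D′)
          ... | inj₂ v∈D  = D⊆S v∈D

          y∉∪ : y ∉ D′ ∪ D
          y∉∪ y∈ with x∈p∪q⁻ D′ D y∈
          ... | inj₁ y∈D′ = y∉ y∈D′
          ... | inj₂ y∈D  = y∉D y∈D

          closed∪ : Closed S (D′ ∪ D)
          closed∪ u∈ v∈ v∉ e with x∈p∪q⁻ D′ D u∈
          ... | inj₁ u∈D′ = cl u∈D′ (x∈p∧x∉q⇒x∈p─q v∈ (v∉ ∘ x∈p∪q⁺ ∘ inj₂)) (v∉ ∘ x∈p∪q⁺ ∘ inj₁) e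
          ... | inj₂ u∈D  = v∉ (x∈p∪q⁺ (inj₁
                (subst (_∈ D′) (≡.sym (exit u∈D v∈ (v∉ ∘ x∈p∪q⁺ ∘ inj₂) e)) c∈)))

    module Combine (P : LongPath F c h) where

      open LongPath P using () renaming
        (weight to W; target to a; edges to i; path to p; bonus to ha>0; tree to t₂; height to below₂)

      W>0 : 0 < W
      W>0 = ≤-trans ha>0 (ℕ.m≤n+m (h a) i)

      combine : LongPath E y (h⁺ W W>0) → LongPath S y h
      combine Q with attach sep (LongPath.tree Q) t₂
      ... | t′ , lv∉ , lv∈ = result
        where
        open LongPath Q using () renaming
          (weight to V; target to b; edges to m; path to q; bonus to h⁺b>0; tree to t; height to below)

        g : Fin n → ℕ
        g = h⁺ W W>0

        below′ : HeightAtMostWith t′ h V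
        below′ {v} v∈ with v ∈? D
        ... | yes v∈D rewrite lv∈ v∈D =
              <-≤-trans (ℕ.+-monoˡ-< (level t c) (proj₁ (below₂ v∈F))) W+c≤V ,
              ≤-trans (≤-reflexive (≡.trans (ℕ.+-assoc (level t₂ v) (level t c) (h v))
                         (≡.trans (cong (level t₂ v +_) (ℕ.+-comm (level t c) (h v)))
                           (≡.sym (ℕ.+-assoc (level t₂ v) (h v) (level t c))))))
                (≤-trans (ℕ.+-monoˡ-≤ (level t c) (proj₂ (below₂ v∈F))) W+c≤V)
              where
              v∈F = x∈p∪q⁺ (inj₁ v∈D)
              -- The bound of `Q` at `c`, whose bonus is at least `W`, leaves the room that `t₂`
              -- needs when its root sits on the level of `c`.
              W+c≤V : W + level t c ≤ V
              W+c≤V = ≤-trans (≤-reflexive (ℕ.+-comm W (level t c)))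
                (≤-trans (ℕ.+-monoʳ-≤ (level t c) (W≤h⁺c W W>0)) (proj₂ (below c∈E)))
        ... | no v∉D rewrite lv∉ v∉D =
              proj₁ (below v∈E) , ≤-trans (ℕ.+-monoʳ-≤ (level t v) (h≤h⁺ W W>0 v)) (proj₂ (below v∈E))
              where v∈E = x∈p∧x∉q⇒x∈p─q v∈ v∉D

        stop : g b ≡ h b → LongPath S y h
        stop eq = record
          { target = b ; edges = m ; path = Path-mono E⊆S q
          ; bonus = subst (0 <_) eq h⁺b>0
          ; tree = t′ ; height = subst (λ e → HeightAtMostWith t′ h (m + e)) eq below′ }

        result : LongPath S y h
        result with b ≟ c
        ... | no b≢c = stop (h⁺-≢ W W>0 b≢c)
        -- The path ends at `c`. If its raised bonus is still `h c`, the path stands as it is; if it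
        -- is `W`, the path goes on along `p` to `a`, and the weight remains `m + W`, which is
        -- `m + i + h a`.
        ... | yes refl with ℕ.⊔-sel (h c) W
        ...   | inj₁ ⊔≡h = stop (≡.trans (h⁺-c W W>0) ⊔≡h)
        ...   | inj₂ ⊔≡W = record
                { target = a ; edges = m + i ; path = Path-append E⊆S F⊆S E∩F q p
                ; bonus = ha>0
                ; tree = t′
                ; height = subst (HeightAtMostWith t′ h)
                    (≡.trans (cong (m +_) (≡.trans (h⁺-c W W>0) ⊔≡W)) (≡.sym (ℕ.+-assoc m i (h a)))) below′ }

  -- No separation exists.

  module Inseparable {S y h} (adm : Admissible S y h) (¬sep : ¬ ∃₂ (Separation S y)) where

    open Admissible adm

    -- A closed set avoiding `c` would be separated by `y`, with `c` left over. A set with only exit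
    -- `d` and no neighbour of `y` would be separated by `d`, with `y` left over. If `y` had no
    -- neighbour in `S - y`, that set would be closed in `S`.
    admissible-minus : ∀ {c} → c ∈ S - y → Admissible (S - y) c (nbr y)
    admissible-minus {c} c∈ = record
      { root∈     = c∈
      ; connected = λ {D} D⊆ c∉ ne cl → ¬sep (y , D , record
          { D⊆S = x∈p-y⇒x∈p ∘ D⊆ ; y∉D = y∉p-y S ∘ D⊆ ; nonempty = ne ; c∈S = root∈ ; c∉D = y∉p-y S ∘ D⊆
          ; exit = λ {u} {v} u∈ v∈ v∉ e → exits-to-y cl u∈ v∈ v∉ e
          ; other = c , x∈p-y⇒x∈p c∈ , c∉ , x∈p-y⇒x≢y c∈ })
      ; targeted  = λ {D} {d} D⊆ c∉ ne d∈ d∉ ex none → ¬sep (d , D , record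
          { D⊆S = x∈p-y⇒x∈p ∘ D⊆ ; y∉D = y∉p-y S ∘ D⊆ ; nonempty = ne ; c∈S = x∈p-y⇒x∈p d∈ ; c∉D = d∉
          ; exit = λ u∈ v∈ v∉ e → ex u∈ (x∈p∧x≢y⇒x∈p-y v∈ (avoids-y none u∈ e)) v∉ e
          ; other = y , root∈ , y∉p-y S ∘ D⊆ , ≢-sym (x∈p-y⇒x≢y d∈) })
      ; hasTarget = λ none → connected x∈p-y⇒x∈p (y∉p-y S) (c , c∈)
          λ u∈ v∈ v∉ e → v∉ (x∈p∧x≢y⇒x∈p-y v∈ (avoids-y none u∈ e))
      }
      where
      exits-to-y : ∀ {D} → Closed (S - y) D → OnlyExit S D y
      exits-to-y cl {v = v} u∈ v∈ v∉ e with v ≟ y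
      ... | yes v≡y = v≡y
      ... | no  v≢y = contradiction e (cl u∈ (x∈p∧x≢y⇒x∈p-y v∈ v≢y) v∉)

      avoids-y : ∀ {D u v} → NoTarget (nbr y) D → u ∈ D → Adj G u v → v ≢ y
      avoids-y none u∈ e refl = nbr-zero (none u∈) e

    extend : ∀ {c} → c ∈ S - y → (∀ {v} → v ∈ S - y → h v ≤ h c) → LongPath (S - y) c (nbr y) → LongPath S y h
    extend {c} c∈ max P with addRoot root∈ c∈ (LongPath.tree P)
    ... | t′ , lv = result
      where
      open LongPath P using (target; edges; path; bonus; tree; height)

      nbr≡1 : nbr y target ≡ 1
      nbr≡1 = proj₂ (nbr-adj bonus)

      edges+1 : edges + nbr y target ≡ suc edges
      edges+1 = ≡.trans (cong (edges +_) nbr≡1) (ℕ.+-comm edges 1)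

      -- `S - y` can be left only through `y`, so it contains a target, and the maximum `h c` is
      -- positive.
      hc>0 : 0 < h c
      hc>0 = ℕ.n≢0⇒n>0 λ hc≡0 →
        targeted x∈p-y⇒x∈p (y∉p-y S) (c , c∈) root∈ (y∉p-y S)
          (λ {_} {v} u∈ v∈ v∉ e → case v ≟ y of λ where
            (yes v≡y) → v≡y
            (no  v≢y) → contradiction (x∈p∧x≢y⇒x∈p-y v∈ v≢y) v∉)
          (λ a∈ → ℕ.n≤0⇒n≡0 (≤-trans (max a∈) (≤-reflexive hc≡0)))

      -- The path of weight `V` steps from `y` to `target` and follows `path` backwards to `c`; the
      -- added edge pays for the level that `y` adds on top.
      V : ℕ
      V = suc edges + h c

      below : ∀ {v} → v ∈ S → v ≢ y → level t′ v < V × level t′ v + h v ≤ V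
      below {v} v∈ v≢y rewrite lv v≢y =
        ≤-trans (s≤s lv<) (ℕ.m<m+n (suc edges) hc>0) ,
        ℕ.+-mono-≤ lv< (max v∈′)
        where
        v∈′ = x∈p∧x≢y⇒x∈p-y v∈ v≢y
        lv< : level tree v < suc edges
        lv< = subst (level tree v <_) edges+1 (proj₁ (height v∈′))

      long : Path S y c (suc edges)
      long = root∈ ∷⟨ sym G (proj₁ (nbr-adj bonus)) ⟩ Path-reverse path

      result : LongPath S y h
      -- `c` maximises `h` only over `S - y`, so the bonus of the root may still exceed `V`. Then
      -- the one-vertex path at `y` has weight `h y`, large enough for the same tree.
      result with h y ≤? V
      ... | yes hy≤V = record
            { target = c ; edges = suc edges ; path = long ; bonus = hc>0 ; tree = t′
            ; height = λ {v} v∈ → case v ≟ y of λ where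
                (no  v≢y)  → below v∈ v≢y
                (yes refl) → subst (λ l → l < V × l + h y ≤ V) (≡.sym (level-root t′)) (s≤s z≤n , hy≤V) }
      ... | no hy≰V = record
            { target = y ; edges = 0 ; path = [ root∈ ] ; bonus = hy>0 ; tree = t′
            ; height = λ {v} v∈ → case v ≟ y of λ where
                (no  v≢y)  → ≤-trans (proj₁ (below v∈ v≢y)) V≤hy , ≤-trans (proj₂ (below v∈ v≢y)) V≤hy
                (yes refl) → subst (λ l → l < h y × l + h y ≤ h y) (≡.sym (level-root t′)) (hy>0 , ≤-refl) }
        where
        V≤hy : V ≤ h y
        V≤hy = ℕ.<⇒≤ (ℕ.≰⇒> hy≰V)
        hy>0 : 0 < h y
        hy>0 = ≤-trans (s≤s z≤n) V≤hy

    trivialPath : ¬ Nonempty (S - y) → LongPath S y h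
    trivialPath empty = record
      { target = y ; edges = 0 ; path = [ root∈ ] ; bonus = hy>0 ; tree = singletonTree only
      ; height = λ {v} v∈ → hy>0 , ≤-reflexive (cong h (only v∈)) }
      where
      only : ∀ {v} → v ∈ S → v ≡ y
      only {v} v∈ with v ≟ y
      ... | yes v≡y = v≡y
      ... | no  v≢y = contradiction (v , x∈p∧x≢y⇒x∈p-y v∈ v≢y) empty

      hy>0 : 0 < h y
      hy>0 = ℕ.n≢0⇒n>0 λ hy≡0 → hasTarget λ a∈ → ≡.trans (cong h (only a∈)) hy≡0

  -- `F` is solved before `E`, since its weight fixes the bonus of `c` in `E`.
  longPath : ∀ m S y h → ∣ S ∣ < m → Admissible S y h → LongPath S y h
  longPath (suc m) S y h S<m adm with separation? S y
  ... | yes (c , D , sep) = combine (longPath m E y (h⁺ W W>0) (≤-trans ∣E∣<∣S∣ (s≤s⁻¹ S<m)) (admissible-E W W>0))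
    where
    open Separated adm sep
    P : LongPath F c h
    P = longPath m F c h (≤-trans ∣F∣<∣S∣ (s≤s⁻¹ S<m)) admissible-F
    W = LongPath.weight P
    open Combine P
  ... | no ¬sep with nonempty? (S - y)
  ...   | no empty = Inseparable.trivialPath adm ¬sep empty
  ...   | yes ne with ∃-argmax h (S - y) ne
  ...     | c , c∈ , max = extend c∈ max
            (longPath m (S - y) c (nbr y)
              (≤-trans (x∈p⇒∣p-x∣<∣p∣ (Admissible.root∈ adm)) (s≤s⁻¹ S<m)) (admissible-minus c∈))
    where open Inseparable adm ¬sep

  -- Cycles through an edge

  module _ (tc : TwoConnected G) {x y : Fin n} (xy : Adj G x y) where

    y≢x : y ≢ x
    y≢x refl = irrefl G xy

    y∈ : y ∈ ⊤ - x
    y∈ = x∈p∧x≢y⇒x∈p-y ∈⊤ y≢x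

    -- Deleting `x` gives `connected`. Deleting `c` gives `targeted`: a walk from `D` to `x`
    -- avoiding `c` leaves `D` by an edge that does not end at `c`, nor at `x` if `D` has no
    -- neighbour of `x`, against the only exit.
    admissible : Admissible (⊤ - x) y (nbr x)
    admissible = record
      { root∈     = y∈
      ; connected = λ {D} D⊆ y∉ (d , d∈) cl →
          let u , v , u∈ , v∉ , e , _ , v≢x =
                Star-crossing D (proj₂ (proj₂ tc) x d y (x∈p-y⇒x≢y (D⊆ d∈)) y≢x) d∈ y∉
          in cl u∈ (x∈p∧x≢y⇒x∈p-y ∈⊤ v≢x) v∉ e
      ; targeted  = λ {D} {c} D⊆ y∉ (d , d∈) c∈ c∉ ex none →
          let u , v , u∈ , v∉ , e , _ , v≢c = Star-crossing D
                (proj₂ (proj₂ tc) c d x (λ { refl → c∉ d∈ }) (≢-sym (x∈p-y⇒x≢y c∈))) d∈ (y∉p-y ⊤ ∘ D⊆)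
          in v≢c (ex u∈ (x∈p∧x≢y⇒x∈p-y ∈⊤ λ v≡x → nbr-zero (none u∈) (subst (Adj G u) v≡x e)) v∉ e)
      ; hasTarget = λ none → nbr-zero (none y∈) (sym G xy)
      }

    -- A path with k edges from `y` to a neighbour of `x` closes through `x` to a cycle on k + 2
    -- vertices. The tree has levels at most k; putting `x` on top and counting vertices from 1 adds
    -- 2 as well.
    longCycle : Σ (Cycle G) λ C → EdgeOfCycle x y C × TdAtMost G (cycleLength C)
    longCycle with longPath _ (⊤ - x) y (nbr x) ≤-refl admissible
    ... | P with addRoot ∈⊤ y∈ (LongPath.tree P) | Path-vertices (LongPath.path P)
    ...   | t , lv | vs , len , last , vs∈ , uniq , link = C , inj₁ (here refl) , forest , elim , high
      where
      open LongPath P using (target; edges; bonus; tree; height)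

      a-x : Adj G target x × nbr x target ≡ 1
      a-x = nbr-adj bonus

      edges+1 : edges + nbr x target ≡ suc (length vs)
      edges+1 = ≡.trans (cong (edges +_) (proj₂ a-x)) (≡.trans (ℕ.+-comm edges 1) (cong suc (≡.sym len)))

      below : ∀ {v} → v ≢ x → level tree v ≤ length vs
      below {v} v≢x = s≤s⁻¹ (subst (level tree v <_) edges+1 (proj₁ (height (x∈p∧x≢y⇒x∈p-y ∈⊤ v≢x))))

      -- A third vertex lies below the root `y`, hence on a positive level, so the height bound
      -- forces the path to have an edge.
      long : 1 ≤ length vs
      long with third-element (proj₁ tc) x y
      ... | z , z≢x , z≢y with up-step tree (x∈p∧x≢y⇒x∈p-y ∈⊤ z≢x) z≢y
      ...   | _ , _ , _ , lv≡ = ≤-trans (s≤s z≤n) (subst (_≤ length vs) lv≡ (below z≢x))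

      C : Cycle G
      C = mkCycle x (y ∷ vs) (s≤s (s≤s long)) (All-map (λ v∈ → ≢-sym (x∈p-y⇒x≢y v∈)) vs∈ ∷ uniq) (xy ∷ link)
        (subst (λ v → Adj G v x) (≡.sym last) (proj₁ a-x))

      forest : RootedForest n
      forest = record
        { parent = up t
        ; depth = suc ∘ level t
        ; depth-root = depth-root′
        ; depth-step = λ v u eq → case up-step t ∈⊤ (up≢root t eq) of λ where
            (w , _ , eq′ , lv≡) → cong suc (≡.trans lv≡
              (cong (suc ∘ level t) (just-injective (≡.trans (≡.sym eq′) eq))))
        }
        where
        depth-root′ : ∀ v → up t v ≡ nothing → suc (level t v) ≡ 1
        depth-root′ v eq with v ≟ x
        ... | yes refl = cong suc (level-root t)
        ... | no  v≢x with up-step t ∈⊤ v≢x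
        ...   | _ , _ , eq′ , _ with () ← ≡.trans (≡.sym eq) eq′

      elim : IsEliminationForest G forest
      elim u v = comparable t ∈⊤ ∈⊤

      high : HeightAtMost forest (cycleLength C)
      high v with v ≟ x
      ... | yes refl rewrite level-root t = s≤s z≤n
      ... | no  v≢x  rewrite lv v≢x = s≤s (s≤s (below v≢x))

-- The bound by the circumference.

TdAtMost-mono : {G : Graph n} → k ≤ l → TdAtMost G k → TdAtMost G l
TdAtMost-mono k≤l (F , elim , high) = F , elim , λ v → ≤-trans (high v) k≤l

theorem2 : ∀ {n} (G : Graph n) → TwoConnected G →
    (∀ x y → Adj G x y → Σ (Cycle G) λ C → EdgeOfCycle x y C × TdAtMost G (cycleLength C))
    × (∀ c → IsCircumference G c → TdAtMost G c)
theorem2 G tc = (λ x y xy → longCycle G tc xy) , circumference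
  where
  circumference : ∀ c → IsCircumference G c → TdAtMost G c
  -- The first edge of a longest cycle lies on a cycle whose length bounds the treedepth and is at
  -- most `c`.
  circumference c ((mkCycle _ _ _ _ (xy ∷ _) _ , _) , longest) =
    let C , _ , td = longCycle G tc xy in TdAtMost-mono {G = G} (longest C) td
  circumference c ((mkCycle _ _ (s≤s ()) _ [-] _ , _) , _)
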